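{- Let $G$ be a finite loopless graph. The R-cocore of $G$ is unique up to isomorphism; that is, any two R-cocores of $G$ are isomorphic.
   Context: Graphs are finite and undirected. For a finite set $B$ and a relation $R\subseteq V_H\times B$ with full image (every $b\in B$ has some $v$ with $(v,b)\in R$), $H\ast R$ is the graph with vertex set $B$ and edge set $\{(a,b)\in B\times B: \exists (u,v)\in E_H,\ (u,a)\in R,\ (v,b)\in R\}$. All relations here are required to have full domain. For an induced subgraph $H$ of $G$, an R-coretraction of $H$ to $G$ is a relation $R\subseteq V_H\times V_G$ with $H\ast R=G$ and $(x,x)\in R$ for all $x\in V_H$; in this case $H$ is called an R-coretract of $G$. An R-cocore of $G$ is an R-coretract $H$ of $G$ such that no proper induced subgraph of $H$ is an R-coretract of $H$. -}

module Defs where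

open import Data.Fin.Base using (Fin)
open import Data.Nat.Base using (ℕ)
open import Data.Product.Base using (∃; ∃-syntax; _×_; _,_)
open import Data.Refinement using (Refinement-syntax; value)
open import Function.Bundles using (_↔_; module Inverse) renaming (_⇔_ to _⟺_)
open import Level using (0ℓ; suc)
open import Relation.Binary.Core using (Rel; REL; _⇔_)
open import Relation.Binary.Definitions using (Symmetric; Decidable)
open import Relation.Nullary using (¬_)
import Relation.Unary as Unary
open Unary using (Pred)

-- Undirected graphs without multiple edges; loops are allowed.
record Graph : Set (suc 0ℓ) where
  infix 4 _~_
  field
    Vertex    : Set
    _~_       : Rel Vertex 0ℓ
    symmetric : Symmetric _~_

open Graph public using (Vertex)

Edge : (G : Graph) → Rel (Vertex G) 0ℓ
Edge = Graph._~_

record IsFinite (G : Graph) : Set where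
  field
    order       : ℕ
    enumeration : Vertex G ↔ Fin order
    edge?       : Decidable (Edge G)

Loopless : Graph → Set
Loopless G = ∀ v → ¬ Edge G v v

infix 4 _≅_

record _≅_ (G H : Graph) : Set where
  field
    vertices : Vertex G ↔ Vertex H
  open Inverse vertices public using (to; from)
  field
    edges : ∀ u v → Edge G u v ⟺ Edge H (to u) (to v)

-- The induced subgraph.  The refinement type makes membership proofs
-- irrelevant, so each vertex satisfying S occurs exactly once.
infixl 8 _[_]

_[_] : (G : Graph) → Pred (Vertex G) 0ℓ → Graph
G [ S ] = record
  { Vertex    = [ v ∈ Vertex G ∣ S v ]
  ; _~_       = λ u v → Edge G (value u) (value v)
  ; symmetric = Graph.symmetric G
  }

FullDomain : {A B : Set} → REL A B 0ℓ → Set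
FullDomain R = ∀ a → ∃[ b ] R a b

FullImage : {A B : Set} → REL A B 0ℓ → Set
FullImage R = ∀ b → ∃[ a ] R a b

infixl 7 _∗_

_∗_ : (H : Graph) {B : Set} → REL (Vertex H) B 0ℓ → Graph
_∗_ H {B} R = record
  { Vertex    = B
  ; _~_       = λ a b → ∃[ u ] ∃[ v ] (Edge H u v × R u a × R v b)
  ; symmetric = λ (u , v , u~v , ua , vb) →
                  v , u , Graph.symmetric H u~v , vb , ua
  }

-- Vertex subsets and relations are required to be decidable: over finite
-- sets these are the subsets of classical finite combinatorics.
record IsRCoretraction (G : Graph) (S : Pred (Vertex G) 0ℓ)
                       (R : REL (Vertex (G [ S ])) (Vertex G) 0ℓ) : Set where
  field
    decidable  : Decidable R
    fullDomain : FullDomain R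
    fullImage  : FullImage R
    sameEdges  : Edge (G [ S ] ∗ R) ⇔ Edge G
    reflexive  : ∀ x → R x (value x)

record IsRCoretract (G : Graph) (S : Pred (Vertex G) 0ℓ) : Set (suc 0ℓ) where
  field
    member?      : Unary.Decidable S
    coretraction : ∃ (IsRCoretraction G S)

Proper : {A : Set} → Pred A 0ℓ → Set
Proper S = ∃[ x ] ¬ S x

record IsRCocore (G : Graph) (S : Pred (Vertex G) 0ℓ) : Set (suc 0ℓ) where
  field
    isRCoretract : IsRCoretract G S
    minimal      : ∀ T → Proper T → ¬ IsRCoretract (G [ S ]) T

-- Write N(v) for the neighbourhood of v.  If R is an R-coretraction of G[S]
-- to G, then (u , a) ∈ R forces N(u) ⊆ N(a), and every N(a) is a nonempty
-- union of sets N(u) with u ∈ S; conversely, for any such S the relation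
-- N(u) ⊆ N(a) is an R-coretraction.  Minimality of S therefore means that no
-- N(x), x ∈ S, is a union of the N(u) with u ∈ S ∖ {x}.  Given a second
-- R-cocore T, writing N(x) as a union of N(y), y ∈ T, and each of these as a
-- union over S shows that some y ∈ T has N(y) = N(x).  This y is unique, and
-- exchanging vertices with equal neighbourhoods preserves edges.
module Submission where

open import Data.Fin.Properties using (all?; any?; inj⇒≟)
open import Data.Irrelevant using () renaming ([_] to squash)
open import Data.Product.Base using (∃; ∃-syntax; _×_; _,_; proj₁; proj₂; swap)
open import Data.Refinement using (Refinement; _,_; value)
open import Defs
open import Function.Base using (_∘_)
open import Function.Bundles using (Inverse; mk↔ₛ′; mk⇔)
open import Function.Properties.Inverse using (↔⇒↣)
open import Level using (0ℓ)
open import Relation.Binary.Core using (Rel)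
import Relation.Binary.Definitions as Binary
open import Relation.Binary.PropositionalEquality using (_≡_; refl; sym; subst)
open import Relation.Nullary.Decidable
  using (Dec; yes; no; map′; recompute; decidable-stable; ¬?; _×-dec_; _→-dec_)
open import Relation.Nullary.Negation using (¬_)
open import Relation.Unary using (Pred; Decidable; _⊆′_; _∖_; ｛_｝)

value-injective : {A : Set} {P : Pred A 0ℓ} {x y : Refinement A P} →
                  value x ≡ value y → x ≡ y
value-injective refl = refl

module _ (G : Graph) where

  private
    V = Vertex G
    open Graph G using (_~_; symmetric)

  infix 4 _⊑_ _≈_

  _⊑_ : Rel V 0ℓ
  u ⊑ v = (u ~_) ⊆′ (v ~_)

  _≈_ : Rel V 0ℓ
  u ≈ v = u ⊑ v × v ⊑ u

  ⊑-refl : ∀ {u} → u ⊑ u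
  ⊑-refl _ u~w = u~w

  ⊑-trans : ∀ {u v w} → u ⊑ v → v ⊑ w → u ⊑ w
  ⊑-trans u⊑v v⊑w d = v⊑w d ∘ u⊑v d

  ≈-trans : ∀ {u v w} → u ≈ v → v ≈ w → u ≈ w
  ≈-trans (u⊑v , v⊑u) (v⊑w , w⊑v) = ⊑-trans u⊑v v⊑w , ⊑-trans w⊑v v⊑u

  ~-mono : ∀ {u v a b} → u ⊑ a → v ⊑ b → u ~ v → a ~ b
  ~-mono u⊑a v⊑b u~v = symmetric (v⊑b _ (symmetric (u⊑a _ u~v)))

  -- N(c) is the union of the sets N(u) ⊆ N(c) with u ∈ P.  The first component
  -- excludes the empty union, which matters when c is isolated.
  GeneratedBy : Pred V 0ℓ → Pred V 0ℓ
  GeneratedBy P c = (∃[ u ] (P u × u ⊑ c)) ×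
                    (∀ d → c ~ d → ∃[ u ] (P u × u ⊑ c × u ~ d))

  Generates : Pred V 0ℓ → Set
  Generates P = ∀ c → GeneratedBy P c

  ≈⇒generatedBy : ∀ {P u c} → P u → u ≈ c → GeneratedBy P c
  ≈⇒generatedBy u∈P (u⊑c , c⊑u) =
    (_ , u∈P , u⊑c) , λ d c~d → _ , u∈P , u⊑c , c⊑u d c~d

  -- `step` is told that `u ⊑ c`, so only generators below `c` need replacing, and the replacement
  -- may use the inclusion.
  generatedBy-trans : ∀ {P Q c} → GeneratedBy P c →
                      (∀ {u} → P u → u ⊑ c → GeneratedBy Q u) → GeneratedBy Q c
  generatedBy-trans {P} {Q} {c} ((u , u∈P , u⊑c) , cover) step = below , cover′
    where
    below : ∃[ w ] (Q w × w ⊑ c)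
    below = let (w , w∈Q , w⊑u) , _ = step u∈P u⊑c in w , w∈Q , ⊑-trans w⊑u u⊑c

    cover′ : ∀ d → c ~ d → ∃[ w ] (Q w × w ⊑ c × w ~ d)
    cover′ d c~d =
      let v , v∈P , v⊑c , v~d = cover d c~d
          w , w∈Q , w⊑v , w~d = proj₂ (step v∈P v⊑c) d v~d
      in w , w∈Q , ⊑-trans w⊑v v⊑c , w~d

  module _ {S : Pred V 0ℓ} where

    -- An edge from `u` to `b` lifts to one ending at some `v′` with `R v′ b`. Reflexivity at `v′`
    -- turns this into an edge from `u` to `v′` inside the subgraph, whose image under `R` joins `a`
    -- to `b`.
    coretraction⇒⊑ : ∀ {R} → IsRCoretraction G S R → ∀ {u a} → R u a → value u ⊑ a
    coretraction⇒⊑ isR {u} uRa b u~b =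
      let u′ , v′ , u′~v′ , u′Ru , v′Rb = proj₂ sameEdges u~b
          u~v′ = proj₁ sameEdges (u′ , v′ , u′~v′ , u′Ru , reflexive v′)
      in proj₁ sameEdges (u , v′ , u~v′ , uRa , v′Rb)
      where open IsRCoretraction isR

    coretract⇒generates : IsRCoretract G S → Generates S
    coretract⇒generates isRCoretract c =
      (let u , uRc = fullImage c in value u , member u , coretraction⇒⊑ isR uRc) ,
      λ d c~d →
        let u , v , u~v , uRc , vRd = proj₂ sameEdges c~d
        in value u , member u , coretraction⇒⊑ isR uRc ,
           ~-mono ⊑-refl (coretraction⇒⊑ isR vRd) u~v
      where
      open IsRCoretract isRCoretract
      isR = proj₂ coretraction
      open IsRCoretraction isR

      -- Membership is stored irrelevantly; deciding `S` makes it usable.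
      member : (u : Vertex (G [ S ])) → S (value u)
      member (u , squash u∈S) = recompute (member? u) u∈S

  module _ (finite : IsFinite G) where

    open IsFinite finite

    private
      open Inverse enumeration using (to; from; strictlyInverseʳ)

    _≟_ : Binary.DecidableEquality V
    _≟_ = inj⇒≟ (↔⇒↣ enumeration)

    ∃? : ∀ {P : Pred V 0ℓ} → Decidable P → Dec (∃ P)
    ∃? {P} P? = map′ (λ (i , p) → from i , p)
                  (λ (v , p) → to v , subst P (sym (strictlyInverseʳ v)) p)
                  (any? (P? ∘ from))

    ∀? : ∀ {P : Pred V 0ℓ} → Decidable P → Dec (∀ v → P v)
    ∀? {P} P? = map′ (λ p v → subst P (strictlyInverseʳ v) (p (to v)))
                  (λ p → p ∘ from)
                  (all? (P? ∘ from))

    _⊑?_ : Binary.Decidable _⊑_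
    u ⊑? v = ∀? λ w → edge? u w →-dec edge? v w

    _≈?_ : Binary.Decidable _≈_
    u ≈? v = (u ⊑? v) ×-dec (v ⊑? u)

    -- Wherever `x` serves as a generator, its own generators take its place; every other member of
    -- `S` generates itself.
    generates-∖ : ∀ {S x} → Generates S → GeneratedBy (S ∖ ｛ x ｝) x →
                  Generates (S ∖ ｛ x ｝)
    generates-∖ {S} {x} genS genx c = generatedBy-trans (genS c) step
      where
      step : ∀ {u} → S u → u ⊑ c → GeneratedBy (S ∖ ｛ x ｝) u
      step {u} u∈S _ with x ≟ u
      ... | yes refl = genx
      ... | no  x≢u  = ≈⇒generatedBy (u∈S , x≢u) (⊑-refl , ⊑-refl)

    -- The relation compares neighbourhoods in all of `G`, although the target is only `G [ S ]`;
    -- this suffices because the endpoints of lifted edges are drawn from `S ∖ ｛ x ｝`.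
    generates⇒coretract : ∀ {S x} → Generates (S ∖ ｛ x ｝) →
                          IsRCoretract (G [ S ]) (λ v → ¬ x ≡ value v)
    generates⇒coretract {S} {x} gen = record
      { member?      = λ v → ¬? (x ≟ value v)
      ; coretraction = (λ u a → value (value u) ⊑ value a) , record
        { decidable  = λ u a → value (value u) ⊑? value a
        ; fullDomain = λ u → value u , ⊑-refl
        ; fullImage  = λ a → let (u , u∈ , u⊑a) , _ = gen (value a)
                             in vertex u∈ , u⊑a
        ; sameEdges  = (λ (u , v , u~v , u⊑a , v⊑b) → ~-mono u⊑a v⊑b u~v)
                     , λ {a} {b} a~b →
          -- The endpoints are replaced one at a time: `a` by `u` along the given edge, then `b` by
          -- `v` along the new edge to `u`.
          let u , u∈ , u⊑a , u~b = proj₂ (gen (value a)) (value b) a~b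
              v , v∈ , v⊑b , v~u = proj₂ (gen (value b)) u (symmetric u~b)
          in vertex u∈ , vertex v∈ , symmetric v~u , u⊑a , v⊑b
        ; reflexive  = λ _ → ⊑-refl
        }
      }
      where
      vertex : ∀ {u} → (S ∖ ｛ x ｝) u → Vertex (G [ S ] [ (λ v → ¬ x ≡ value v) ])
      vertex (u∈S , x≢u) = (_ , squash u∈S) , squash x≢u

    module _ {S : Pred V 0ℓ} (cocore : IsRCocore G S) where

      open IsRCocore cocore
      open IsRCoretract isRCoretract using (member?)

      cocore-generates : Generates S
      cocore-generates = coretract⇒generates isRCoretract

      cocore-irredundant : ∀ {x} → S x → ¬ GeneratedBy (S ∖ ｛ x ｝) x
      cocore-irredundant {x} x∈S genx =
        minimal (λ v → ¬ x ≡ value v) ((x , squash x∈S) , λ x≢x → x≢x refl)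
          (generates⇒coretract (generates-∖ cocore-generates genx))

      -- A different `y` with the same neighbourhood would by itself generate `x`.
      cocore-≈⇒≡ : (x y : Vertex (G [ S ])) → value x ≈ value y → x ≡ y
      cocore-≈⇒≡ (x , squash x∈S) (y , squash y∈S) (x⊑y , y⊑x) =
        value-injective (decidable-stable (x ≟ y) λ x≢y →
          cocore-irredundant (recompute (member? x) x∈S)
            (≈⇒generatedBy (recompute (member? y) y∈S , x≢y) (y⊑x , x⊑y)))

    module _ {S T : Pred V 0ℓ} (coS : IsRCocore G S) (coT : IsRCocore G T) where

      private
        module S = IsRCoretract (IsRCocore.isRCoretract coS)
        module T = IsRCoretract (IsRCocore.isRCoretract coT)

      ≈-representative : ∀ {x} → S x → ∃[ y ] (T y × x ≈ y)
      ≈-representative {x} x∈S =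
        -- Finite search lets the representative be found by refuting its absence.
        decidable-stable (∃? λ y → T.member? y ×-dec (x ≈? y)) λ none →
          cocore-irredundant coS x∈S
            (generatedBy-trans (cocore-generates coT x) λ {y} y∈T y⊑x →
              generatedBy-trans (cocore-generates coS y) λ {u} u∈S u⊑y →
                ≈⇒generatedBy
                  -- If `u` were `x`, then `x ⊑ y ⊑ x` would make `y` a representative. So `x` is
                  -- not among its own second-stage generators.
                  (u∈S , λ { refl → none (y , y∈T , u⊑y , y⊑x) })
                  (⊑-refl , ⊑-refl))

      transfer : (x : Vertex (G [ S ])) → ∃[ y ] (value x ≈ value {P = T} y)
      transfer (x , squash x∈S) =
        let y , y∈T , x≈y = ≈-representative (recompute (S.member? x) x∈S)
        in (y , squash y∈T) , x≈y

    cocores-≅ : ∀ {S T} → IsRCocore G S → IsRCocore G T → G [ S ] ≅ G [ T ]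
    cocores-≅ {S} {T} coS coT = record
      -- A round trip stays within one `≈`-class, and a cocore meets each class at most once.
      { vertices = mk↔ₛ′ (proj₁ ∘ S→T) (proj₁ ∘ T→S)
          (λ y → let x , y≈x = T→S y
                 in cocore-≈⇒≡ coT _ y (swap (≈-trans y≈x (proj₂ (S→T x)))))
          (λ x → let y , x≈y = S→T x
                 in cocore-≈⇒≡ coS _ x (swap (≈-trans x≈y (proj₂ (T→S y)))))
      ; edges = λ u v →
          let u⊑u′ , u′⊑u = proj₂ (S→T u)
              v⊑v′ , v′⊑v = proj₂ (S→T v)
          in mk⇔ (~-mono u⊑u′ v⊑v′) (~-mono u′⊑u v′⊑v)
      }
      where
      S→T = transfer coS coT
      T→S = transfer coT coS

proposition4p4p14 : (G : Graph) → IsFinite G → Loopless G →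
    (S T : Pred (Vertex G) 0ℓ) → IsRCocore G S → IsRCocore G T →
    G [ S ] ≅ G [ T ]
proposition4p4p14 G finite _ S T = cocores-≅ G finite
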